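{- There exists an absolute constant $c>0$ such that for all sufficiently large primes $q$, $$\mathrm{Nikodym}(2,q)\ \le\ q^2-q^{1+c}.$$
   Context: For $x\in\mathbb{F}_q^d$ and $v\in\mathbb{F}_q^d\setminus\{0\}$ write $\ell(x,v)^*=\{x+tv: t\in\mathbb{F}_q\}\setminus\{x\}$. A set $N\subset\mathbb{F}_q^d$ is a Nikodym set if for every $x\in\mathbb{F}_q^d$ there exists $v\in\mathbb{F}_q^d\setminus\{0\}$ such that $\ell(x,v)^*\subset N$. $\mathrm{Nikodym}(d,q)$ denotes the size of the smallest Nikodym set in $\mathbb{F}_q^d$. -}

module Defs where

open import Data.Fin.Base using (Fin; toℕ; funToFin; finToFun)
open import Data.Fin.Properties as Fin using (any?; all?; finToFun-funToFin)
open import Data.Fin.Subset using (Subset; _∈_; ∣_∣; ⊤)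
open import Data.Fin.Subset.Properties using (_∈?_; ∈⊤; anySubset?)
open import Data.Integer.Base using (+_; -[1+_])
open import Data.Nat.Base
open import Data.Nat.DivMod using (_mod_; m<n⇒m%n≡m)
open import Data.Nat.Primality using (Prime; prime⇒nonZero; prime⇒nonTrivial)
import Data.Nat.Properties as ℕ
open import Data.Product.Base using (∃; _×_; _,_; proj₁; proj₂)
open import Data.Rational.Base using (ℚ; ↥_; ↧ₙ_)
open import Data.Vec.Base using (Vec; _∷_; map; zipWith; replicate; lookup; tabulate)
open import Data.Vec.Properties using (≡-dec; ∷-injectiveˡ; tabulate∘lookup; tabulate-cong)
open import Function.Base using (_∘_)
open import Level using (0ℓ)
open import Relation.Binary.PropositionalEquality
open import Relation.Nullary.Decidable using (Dec; yes; no; map′; ¬?; _×-dec_; _→-dec_)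
open import Relation.Nullary.Negation using (contradiction)
open import Relation.Unary using (Pred; Decidable)

-- For q prime, the field with q elements is ℤ/qℤ, represented by residues.
𝔽 : ℕ → Set
𝔽 = Fin

Point : ℕ → ℕ → Set
Point d q = Vec (𝔽 q) d

-- A subset of 𝔽_q^d is a Subset (q ^ d), where a point corresponds to its
-- index under the bijection between Fin d → Fin q and Fin (q ^ d).  Hence ∣_∣
-- counts the points of the set.
PointSet : ℕ → ℕ → Set
PointSet d q = Subset (q ^ d)

module _ {d q : ℕ} where

  index : Point d q → Fin (q ^ d)
  index x = funToFin (lookup x)

  infix 4 _∈ₚ_
  _∈ₚ_ : Point d q → PointSet d q → Set
  x ∈ₚ N = index x ∈ N

module _ {q : ℕ} .{{pr : Prime q}} where

  fromℕ : ℕ → 𝔽 q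
  fromℕ n = _mod_ n q {{prime⇒nonZero pr}}

  infixl 6 _+𝔽_
  infixl 7 _*𝔽_

  _+𝔽_ _*𝔽_ : 𝔽 q → 𝔽 q → 𝔽 q
  a +𝔽 b = fromℕ (toℕ a + toℕ b)
  a *𝔽 b = fromℕ (toℕ a * toℕ b)

  module _ {d : ℕ} where

    infixl 6 _⊕_
    infixl 7 _⊙_

    _⊕_ : Point d q → Point d q → Point d q
    _⊕_ = zipWith _+𝔽_

    _⊙_ : 𝔽 q → Point d q → Point d q
    t ⊙ v = map (t *𝔽_) v

    𝟎 : Point d q
    𝟎 = replicate d (fromℕ 0)

    ℓ* : (x v : Point d q) → Pred (Point d q) 0ℓ
    ℓ* x v y = ∃ (λ t → y ≡ x ⊕ t ⊙ v) × y ≢ x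

IsNikodym : (d q : ℕ) .{{_ : Prime q}} → PointSet d q → Set
IsNikodym d q N = ∀ (x : Point d q) → ∃ λ (v : Point d q) → v ≢ 𝟎 × (∀ y → ℓ* x v y → y ∈ₚ N)

IsNikodymSize : (d q : ℕ) .{{_ : Prime q}} → ℕ → Set
IsNikodymSize d q n = ∃ λ (N : PointSet d q) → IsNikodym d q N × ∣ N ∣ ≡ n

IsLeast : Pred ℕ 0ℓ → ℕ → Set
IsLeast P n = P n × (∀ m → P m → n ≤ m)

least : {P : Pred ℕ 0ℓ} → Decidable P → ∃ P → ∃ (IsLeast P)
least {P} P? (n , pn) = go n P P? pn
  where
  go : ∀ n (P : Pred ℕ 0ℓ) → Decidable P → P n → ∃ (IsLeast P)
  go zero    P P? pn = 0 , pn , λ _ _ → z≤n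
  go (suc n) P P? pn with P? 0
  ... | yes p₀ = 0 , p₀ , λ _ _ → z≤n
  ... | no ¬p₀ with go n (P ∘ suc) (P? ∘ suc) pn
  ...   | k , pk , min = suc k , pk , λ where
    zero    p₀ → contradiction p₀ ¬p₀
    (suc m) pm → s≤s (min m pm)

module _ {d q : ℕ} where

  private
    point : Fin (q ^ d) → Point d q
    point i = tabulate (finToFun i)

    point-index : ∀ x → point (index x) ≡ x
    point-index x = trans (tabulate-cong (finToFun-funToFin (lookup x))) (tabulate∘lookup x)

  allPoints? : {P : Pred (Point d q) 0ℓ} → Decidable P → Dec (∀ x → P x)
  allPoints? {P} P? = map′ (λ f x → subst P (point-index x) (f (index x)))
                           (λ f i → f (point i)) (all? (P? ∘ point))

  anyPoint? : {P : Pred (Point d q) 0ℓ} → Decidable P → Dec (∃ P)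
  anyPoint? {P} P? = map′ (λ (i , p) → point i , p)
                          (λ (x , p) → index x , subst P (sym (point-index x)) p)
                          (any? (P? ∘ point))

  infix 4 _≟ₚ_
  _≟ₚ_ : (x y : Point d q) → Dec (x ≡ y)
  _≟ₚ_ = ≡-dec Fin._≟_

module _ {d q : ℕ} .{{pr : Prime q}} where

  isNikodym? : Decidable (IsNikodym d q)
  isNikodym? N = allPoints? λ x → anyPoint? λ v →
    ¬? (v ≟ₚ 𝟎) ×-dec allPoints? λ y →
      (any? (λ t → y ≟ₚ x ⊕ t ⊙ v) ×-dec ¬? (y ≟ₚ x)) →-dec (index y ∈? N)

  fromℕ0≢fromℕ1 : fromℕ {q} 0 ≢ fromℕ 1
  fromℕ0≢fromℕ1 eq = contradiction 0≡1 λ ()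
    where
    1<q : 1 < q
    1<q = nonTrivial⇒n>1 q {{prime⇒nonTrivial pr}}
    toℕ-fromℕ : ∀ {n} → n < q → toℕ (fromℕ {q} n) ≡ n
    toℕ-fromℕ n<q = trans (Fin.toℕ-fromℕ< _) (m<n⇒m%n≡m {{prime⇒nonZero pr}} n<q)
    0≡1 : 0 ≡ 1
    0≡1 = trans (sym (toℕ-fromℕ (ℕ.<-trans z<s 1<q))) (trans (cong toℕ eq) (toℕ-fromℕ 1<q))

  ⊤-isNikodym : .{{_ : NonZero d}} → IsNikodym d q ⊤
  ⊤-isNikodym x = replicate d (fromℕ 1) , 𝟏≢𝟎 d , λ _ _ → ∈⊤
    where
    𝟏≢𝟎 : ∀ d .{{_ : NonZero d}} → replicate d (fromℕ 1) ≢ 𝟎 {q}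
    𝟏≢𝟎 (suc d) eq = fromℕ0≢fromℕ1 (sym (∷-injectiveˡ eq))

leastNikodymSize : (d q : ℕ) .{{_ : NonZero d}} .{{_ : Prime q}} → ∃ (IsLeast (IsNikodymSize d q))
leastNikodymSize d q =
  least (λ n → anySubset? λ N → isNikodym? {d} N ×-dec (∣ N ∣ ℕ.≟ n))
        (∣ ⊤ {q ^ d} ∣ , ⊤ , ⊤-isNikodym {d} , refl)

-- In dimension 0 there is no nonzero v, hence no Nikodym set.
Nikodym : (d q : ℕ) .{{_ : NonZero d}} .{{_ : Prime q}} → ℕ
Nikodym d q = proj₁ (leastNikodymSize d q)

-- The inequality b ^ (p / k) ≤ x of real numbers, for b > 0, with both
-- sides raised to the k-th power.
infix 4 _^ℚ_≤_
_^ℚ_≤_ : ℕ → ℚ → ℕ → Set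
b ^ℚ r ≤ x with ↥ r
... | + p      = b ^ p ≤ x ^ ↧ₙ r
... | -[1+ p ] = 1 ≤ b ^ suc p * x ^ ↧ₙ r

-- The inequality n ≤ m - b ^ r of real numbers, for b > 0.  As b ^ r ≥ 0, it
-- entails n ≤ m, so that the truncated subtraction is an actual one.
infix 4 _≤_-[_^ℚ_]
_≤_-[_^ℚ_] : ℕ → ℕ → ℕ → ℚ → Set
n ≤ m -[ b ^ℚ r ] = n ≤ m × b ^ℚ r ≤ (m ∸ n)

{-# OPTIONS --safe #-}
module Submission where

open import Defs

-- Fix a small power L = 17^J and let C consist of the points (a , a² + s) with
-- 0 ≤ a < L and s in a Ruzsa-type set S of integers of size about L², in which
-- no difference is u² for an integer u not divisible by L.  The line of slope
-- 2(X + k) through (X , X² + t) meets C at abscissa X + u exactly when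
-- u² + s = t + 2ku, i.e. (u - k)² = t + k² - s.  For t ∈ S, k = 0 excludes all
-- u ≠ 0 in range.  In general, look at the lowest even place where the base 17
-- digit of t is not allowed in S: a suitable digit of k there makes t + k² - s a
-- nonsquare for all s ∈ S.  So some k < L forces L ∣ u, hence u = 0: the line
-- misses C except possibly at the point itself.  Points with abscissa outside
-- [0 , L) use vertical lines.  Hence the complement of C is a Nikodym set, and
-- |C| = 17^J · 34^J = 2^J L² exceeds a power of q with exponent above 1 as soon
-- as q is comparable to L².  With 6L² ≤ q, congruences modulo q between the
-- integers involved are equalities.
module Construction where

  open import Algebra.Properties.AbelianGroup using (∙-cancelˡ)
  open import Data.Fin.Base as Fin using (Fin; toℕ; fromℕ<; remQuot; combine; finToFun)
  open import Data.Fin.Properties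
    using (all?; any?; toℕ<n; toℕ-fromℕ<; toℕ-injective; suc-injective; combine-remQuot; finToFun-funToFin)
  open import Data.Fin.Subset as Subset using (Subset; _∈_)
  open import Data.Fin.Subset.Properties using (∈⊤; ∣⊤∣≡n; x∈p∧x≢y⇒x∈p-y; x∈p⇒∣p-x∣<∣p∣)
  open import Data.Integer.Base as ℤ using (ℤ; +_; -_; _-_; ∣_∣)
  open import Data.Integer.DivMod using (_%ℕ_; _/ℕ_; n%ℕd<d; a≡a%ℕn+[a/ℕn]*n)
  open import Data.Integer.Divisibility.Signed as ℤ using (_∣_; divides)
  import Data.Integer.Properties as ℤ
  open import Data.Integer.Tactic.RingSolver using (solve-∀)
  open import Data.Nat.Base hiding (_/_; _%_; ∣_-_∣)
  open import Data.Nat.Divisibility as ℕ using (∣⇒≤)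
  open import Data.Nat.DivMod using (_/_; _%_; m%n<n; m≡m%n+[m/n]*n; [m+kn]%n≡m%n)
  open import Data.Nat.Primality using (Prime)
  import Data.Nat.Properties as ℕ
  import Data.Nat.Tactic.RingSolver as ℕ
  open import Data.Product.Base using (∃; ∃-syntax; _×_; _,_; proj₁; proj₂; uncurry)
  open import Data.Sum.Base using (_⊎_; inj₁; inj₂)
  open import Data.Vec.Base using ([]; _∷_; lookup)
  open import Data.Vec.Properties using (∷-injective; ∷-injectiveˡ; ∷-injectiveʳ; tabulate∘lookup; tabulate-cong)
  open import Function.Base using (_∘_)
  open import Function.Definitions using (Injective)
  open import Relation.Binary.PropositionalEquality
  open import Relation.Nullary.Decidable using (Dec; yes; no; from-yes; ¬?; _×-dec_; _⊎-dec_; _→-dec_)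
  open import Relation.Nullary.Negation using (contradiction)

  -- Integer congruences and division with remainder.

  ∣∣<⇒≡0 : ∀ {d z} → + d ∣ z → ∣ z ∣ < d → z ≡ + 0
  ∣∣<⇒≡0 {d} {z} d∣z ∣z∣<d = ℤ.∣i∣≡0⇒i≡0 (go ∣ z ∣ (ℤ.∣⇒∣ᵤ d∣z) ∣z∣<d)
    where
    go : ∀ n → d ℕ.∣ n → n < d → n ≡ 0
    go zero    _   _   = refl
    go (suc n) d∣n n<d = contradiction (∣⇒≤ d∣n) (ℕ.<⇒≱ n<d)

  ∣m-n∣<d : ∀ {d m n} → m < n + d → n < m + d → ∣ + m - + n ∣ < d
  ∣m-n∣<d {d} {m} {n} m<n+d n<m+d rewrite ℤ.m-n≡m⊖n m n with ℕ.≤-total m n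
  ... | inj₁ m≤n rewrite ℤ.∣⊖∣-≤ m≤n = ℕ.+-cancelˡ-< m _ _ (subst (_< m + d) (sym (ℕ.m+[n∸m]≡n m≤n)) n<m+d)
  ... | inj₂ n≤m rewrite ℤ.⊖-≥ n≤m   = ℕ.+-cancelˡ-< n _ _ (subst (_< n + d) (sym (ℕ.m+[n∸m]≡n n≤m)) m<n+d)

  -- The bridge from congruences to equalities, used modulo `q` and modulo `L`. The two bounds
  -- express that `m` and `n` are less than `d` apart without subtraction in ℕ.
  congruent-close⇒≡ : ∀ {d m n} → + d ∣ + m - + n → m < n + d → n < m + d → m ≡ n
  congruent-close⇒≡ d∣m-n m<n+d n<m+d =
    ℤ.+-injective (ℤ.i-j≡0⇒i≡j _ _ (∣∣<⇒≡0 d∣m-n (∣m-n∣<d m<n+d n<m+d)))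

  ∣-resp : ∀ {d x y} → x ≡ y → d ∣ x → d ∣ y
  ∣-resp refl d∣x = d∣x

  -- The quotients range over ℤ because the abscissa difference `u` can be negative.
  remainder-unique : ∀ {d m n} x y → + m ℤ.+ + d ℤ.* x ≡ + n ℤ.+ + d ℤ.* y →
                     m < d → n < d → m ≡ n
  remainder-unique {d} {m} {n} x y eq m<d n<d =
    congruent-close⇒≡ (divides (y - x) (ℤ.i-j≡0⇒i≡j _ _ (trans (move (+ m) (+ n) (+ d) x y) (ℤ.i≡j⇒i-j≡0 eq))))
      (ℕ.<-≤-trans m<d (ℕ.m≤n+m d n)) (ℕ.<-≤-trans n<d (ℕ.m≤n+m d m))
    where
    move : ∀ m n d x y → m - n - (y - x) ℤ.* d ≡ m ℤ.+ d ℤ.* x - (n ℤ.+ d ℤ.* y)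
    move = solve-∀

  quotient-unique : ∀ {d m n} x y .{{_ : NonZero d}} → + m ℤ.+ + d ℤ.* x ≡ + n ℤ.+ + d ℤ.* y →
                    m ≡ n → x ≡ y
  quotient-unique {suc d} {m} x y eq refl = ℤ.*-cancelˡ-≡ (+ suc d) x y (∙-cancelˡ ℤ.+-0-abelianGroup (+ m) _ _ eq)

  pos-euclid : ∀ m d n → + (m + d * n) ≡ + m ℤ.+ + d ℤ.* + n
  pos-euclid m d n = cong (λ z → + m ℤ.+ z) (ℤ.pos-* d n)

  euclid : ∀ m d .{{_ : NonZero d}} → + m ≡ + (m % d) ℤ.+ + d ℤ.* + (m / d)
  euclid m d = trans (cong +_ (trans (m≡m%n+[m/n]*n m d) (cong (λ n → m % d + n) (ℕ.*-comm (m / d) d))))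
                     (pos-euclid (m % d) d (m / d))

  euclidℤ : ∀ u d .{{_ : NonZero d}} → u ≡ + (u %ℕ d) ℤ.+ + d ℤ.* (u /ℕ d)
  euclidℤ u d = trans (a≡a%ℕn+[a/ℕn]*n u d) (cong (λ z → + (u %ℕ d) ℤ.+ z) (ℤ.*-comm (u /ℕ d) (+ d)))

  %-unique : ∀ {m n} d x y .{{_ : NonZero d}} → + m ℤ.+ + d ℤ.* x ≡ + n ℤ.+ + d ℤ.* y → m % d ≡ n % d
  %-unique {m} {n} d x y eq = remainder-unique (+ (m / d) ℤ.+ x) (+ (n / d) ℤ.+ y)
    (trans (regroup (+ (m % d)) (+ d) (+ (m / d)) x) (trans (cong (λ z → z ℤ.+ + d ℤ.* x) (sym (euclid m d)))
      (trans eq (trans (cong (λ z → z ℤ.+ + d ℤ.* y) (euclid n d)) (sym (regroup (+ (n % d)) (+ d) (+ (n / d)) y))))))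
    (m%n<n m d) (m%n<n n d)
    where
    regroup : ∀ r d q x → r ℤ.+ d ℤ.* (q ℤ.+ x) ≡ r ℤ.+ d ℤ.* q ℤ.+ d ℤ.* x
    regroup = solve-∀

  euclid-injective : ∀ d .{{_ : NonZero d}} {m n} x y → m + d * x ≡ n + d * y → m < d → n < d → m ≡ n × x ≡ y
  euclid-injective d {m} {n} x y eq m<d n<d = m≡n , ℤ.+-injective (quotient-unique (+ x) (+ y) eqℤ m≡n)
    where
    eqℤ : + m ℤ.+ + d ℤ.* + x ≡ + n ℤ.+ + d ℤ.* + y
    eqℤ = trans (sym (pos-euclid m d x)) (trans (cong +_ eq) (pos-euclid n d y))
    m≡n : m ≡ n
    m≡n = remainder-unique (+ x) (+ y) eqℤ m<d n<d

  -- Decoding indices into digits.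

  remQuot-injective : ∀ {m} n (i j : Fin (m * n)) → remQuot {m} n i ≡ remQuot n j → i ≡ j
  remQuot-injective {m} n i j eq =
    trans (sym (combine-remQuot {m} n i)) (trans (cong (uncurry combine) eq) (combine-remQuot {m} n j))

  remQuot₂ : ∀ a b n → Fin (a * b * n) → Fin a × Fin b × Fin n
  remQuot₂ a b n i =
    let ab , z = remQuot {a * b} n i
        x , y  = remQuot {a} b ab
    in x , y , z

  remQuot₂-injective : ∀ a b n (i j : Fin (a * b * n)) → remQuot₂ a b n i ≡ remQuot₂ a b n j → i ≡ j
  remQuot₂-injective a b n i j eq = remQuot-injective {a * b} n i j
    (cong₂ _,_ (remQuot-injective {a} b _ _ (cong₂ _,_ (cong proj₁ eq) (cong (proj₁ ∘ proj₂) eq)))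
               (cong (proj₂ ∘ proj₂) eq))

  euclid-< : ∀ {r d x y} → r < d → x < y → r + d * x < d * y
  euclid-< {r} {d} {x} {y} r<d x<y = begin-strict
    r + d * x   <⟨ ℕ.+-monoˡ-< (d * x) r<d ⟩
    d + d * x   ≡⟨ ℕ.*-suc d x ⟨
    d * suc x   ≤⟨ ℕ.*-monoʳ-≤ d x<y ⟩
    d * y       ∎
    where open ℕ.≤-Reasoning

  -- The intersection equation, digit by digit in base p.

  -- The equation u² + s = t + 2ku modulo p: either some k excludes it for all last
  -- digits w * r of s or, as soon as p ∣ k, it determines u and this digit.
  Obstructed Rigid : ∀ p .{{_ : NonZero p}} → ℕ → Fin p → Set
  Obstructed p w t = ∃[ k ] ∀ (r : Fin 2) (u : Fin p) →
    (toℕ u * toℕ u + w * toℕ r) % p ≢ (toℕ t + 2 * toℕ {p} k * toℕ u) % p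
  Rigid p w t = ∀ (r : Fin 2) (u : Fin p) →
    (toℕ u * toℕ u + w * toℕ r) % p ≡ toℕ t % p → toℕ u ≡ 0 × w * toℕ r ≡ toℕ t

  obstructed⊎rigid? : ∀ p .{{_ : NonZero p}} w t → Dec (Obstructed p w t ⊎ Rigid p w t)
  obstructed⊎rigid? p w t =
    any? (λ k → all? λ r → all? λ u → ¬? (_ ℕ.≟ _))
    ⊎-dec all? (λ r → all? λ u → (_ ℕ.≟ _) →-dec (_ ℕ.≟ _) ×-dec (_ ℕ.≟ _))

  -- An equation over ℤ and not modulo `q`, so that it can be read in base `p`; `u` is the signed
  -- offset from the abscissa of the base point.
  Meets : ℕ → ℕ → ℕ → ℤ → Set
  Meets s t k u = u ℤ.* u ℤ.+ + s ≡ + t ℤ.+ + 2 ℤ.* + k ℤ.* u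

  -- For `u = u₀ + d u₁`, every term of `u * u` except `u₀ * u₀` is a multiple of `d`.
  meets-mod : ∀ d .{{_ : NonZero d}} r σ t k u → Meets (r + d * σ) t k u →
              (u %ℕ d * (u %ℕ d) + r) % d ≡ (t % d + 2 * k * (u %ℕ d)) % d
  meets-mod d r σ t k u eq = %-unique d
    (+ 2 ℤ.* + u₀ ℤ.* u₁ ℤ.+ + d ℤ.* u₁ ℤ.* u₁ ℤ.+ + σ) (+ (t / d) ℤ.+ + 2 ℤ.* + k ℤ.* u₁) (begin
      + (u₀ * u₀ + r) ℤ.+ + d ℤ.* (+ 2 ℤ.* + u₀ ℤ.* u₁ ℤ.+ + d ℤ.* u₁ ℤ.* u₁ ℤ.+ + σ)
        ≡⟨ cong (λ z → z ℤ.+ + r ℤ.+ + d ℤ.* (+ 2 ℤ.* + u₀ ℤ.* u₁ ℤ.+ + d ℤ.* u₁ ℤ.* u₁ ℤ.+ + σ)) (ℤ.pos-* u₀ u₀) ⟩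
      + u₀ ℤ.* + u₀ ℤ.+ + r ℤ.+ + d ℤ.* (+ 2 ℤ.* + u₀ ℤ.* u₁ ℤ.+ + d ℤ.* u₁ ℤ.* u₁ ℤ.+ + σ)
        ≡⟨ squareˡ (+ d) (+ u₀) u₁ (+ r) (+ σ) ⟩
      (+ u₀ ℤ.+ + d ℤ.* u₁) ℤ.* (+ u₀ ℤ.+ + d ℤ.* u₁) ℤ.+ (+ r ℤ.+ + d ℤ.* + σ)
        ≡⟨ cong₂ (λ v s → v ℤ.* v ℤ.+ s) (euclidℤ u d) (pos-euclid r d σ) ⟨
      u ℤ.* u ℤ.+ + (r + d * σ)
        ≡⟨ eq ⟩
      + t ℤ.+ + 2 ℤ.* + k ℤ.* u
        ≡⟨ cong₂ (λ s v → s ℤ.+ + 2 ℤ.* + k ℤ.* v) (euclid t d) (euclidℤ u d) ⟩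
      + (t % d) ℤ.+ + d ℤ.* + (t / d) ℤ.+ + 2 ℤ.* + k ℤ.* (+ u₀ ℤ.+ + d ℤ.* u₁)
        ≡⟨ squareʳ (+ d) (+ (t % d)) (+ (t / d)) (+ k) (+ u₀) u₁ ⟩
      + (t % d) ℤ.+ + 2 ℤ.* + k ℤ.* + u₀ ℤ.+ + d ℤ.* (+ (t / d) ℤ.+ + 2 ℤ.* + k ℤ.* u₁)
        ≡⟨ cong (λ z → + (t % d) ℤ.+ z ℤ.+ + d ℤ.* (+ (t / d) ℤ.+ + 2 ℤ.* + k ℤ.* u₁))
             (trans (ℤ.pos-* (2 * k) u₀) (cong (λ z → z ℤ.* + u₀) (ℤ.pos-* 2 k))) ⟨
      + (t % d + 2 * k * u₀) ℤ.+ + d ℤ.* (+ (t / d) ℤ.+ + 2 ℤ.* + k ℤ.* u₁) ∎)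
    where
    open ≡-Reasoning
    u₀ = u %ℕ d
    u₁ = u /ℕ d
    squareˡ : ∀ d u₀ u₁ r σ → u₀ ℤ.* u₀ ℤ.+ r ℤ.+ d ℤ.* (+ 2 ℤ.* u₀ ℤ.* u₁ ℤ.+ d ℤ.* u₁ ℤ.* u₁ ℤ.+ σ)
            ≡ (u₀ ℤ.+ d ℤ.* u₁) ℤ.* (u₀ ℤ.+ d ℤ.* u₁) ℤ.+ (r ℤ.+ d ℤ.* σ)
    squareˡ = solve-∀
    squareʳ : ∀ d t₀ t₁ k u₀ u₁ → t₀ ℤ.+ d ℤ.* t₁ ℤ.+ + 2 ℤ.* k ℤ.* (u₀ ℤ.+ d ℤ.* u₁)
            ≡ t₀ ℤ.+ + 2 ℤ.* k ℤ.* u₀ ℤ.+ d ℤ.* (t₁ ℤ.+ + 2 ℤ.* k ℤ.* u₁)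
    squareʳ = solve-∀

  -- Since `d` divides both the slope correction and the offset, their contributions to the equation
  -- are multiples of `d * d`. The lowest digits agree by hypothesis, the next ones by uniqueness of
  -- remainders, and dividing off both leaves an equation of the same shape. Hence the digits of `s`
  -- at odd places may be arbitrary.
  meets-descend : ∀ d .{{_ : NonZero d}} {r b} s {t} k u → r ≡ t % d → b < d →
                  Meets (r + d * (b + d * s)) t (d * k) (+ d ℤ.* u) → Meets s (t / d / d) k u
  meets-descend d {r} {b} s {t} k u r≡ b<d eq = quotient-unique _ _ eq₂ b≡
    where
    open ≡-Reasoning
    τ = t / d
    expandˡ : ∀ d u r σ → r ℤ.+ d ℤ.* (d ℤ.* (u ℤ.* u) ℤ.+ σ) ≡ (d ℤ.* u) ℤ.* (d ℤ.* u) ℤ.+ (r ℤ.+ d ℤ.* σ)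
    expandˡ = solve-∀
    expandʳ : ∀ d t₀ t₁ k u → t₀ ℤ.+ d ℤ.* t₁ ℤ.+ + 2 ℤ.* (d ℤ.* k) ℤ.* (d ℤ.* u) ≡ t₀ ℤ.+ d ℤ.* (t₁ ℤ.+ d ℤ.* (+ 2 ℤ.* k ℤ.* u))
    expandʳ = solve-∀
    factorˡ : ∀ b d v s → b ℤ.+ d ℤ.* (v ℤ.+ s) ≡ d ℤ.* v ℤ.+ (b ℤ.+ d ℤ.* s)
    factorˡ = solve-∀
    factorʳ : ∀ t₀ d t₁ v → t₀ ℤ.+ d ℤ.* t₁ ℤ.+ d ℤ.* v ≡ t₀ ℤ.+ d ℤ.* (t₁ ℤ.+ v)
    factorʳ = solve-∀
    eq₁ : + d ℤ.* (u ℤ.* u) ℤ.+ + (b + d * s) ≡ + τ ℤ.+ + d ℤ.* (+ 2 ℤ.* + k ℤ.* u)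
    eq₁ = quotient-unique {d} {r} {t % d} _ _ (begin
      + r ℤ.+ + d ℤ.* (+ d ℤ.* (u ℤ.* u) ℤ.+ + (b + d * s))               ≡⟨ expandˡ (+ d) u (+ r) (+ (b + d * s)) ⟩
      (+ d ℤ.* u) ℤ.* (+ d ℤ.* u) ℤ.+ (+ r ℤ.+ + d ℤ.* + (b + d * s))     ≡⟨ cong (λ z → (+ d ℤ.* u) ℤ.* (+ d ℤ.* u) ℤ.+ z) (pos-euclid r d (b + d * s)) ⟨
      (+ d ℤ.* u) ℤ.* (+ d ℤ.* u) ℤ.+ + (r + d * (b + d * s))             ≡⟨ eq ⟩
      + t ℤ.+ + 2 ℤ.* + (d * k) ℤ.* (+ d ℤ.* u)                           ≡⟨ cong₂ (λ s k → s ℤ.+ + 2 ℤ.* k ℤ.* (+ d ℤ.* u)) (euclid t d) (ℤ.pos-* d k) ⟩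
      + (t % d) ℤ.+ + d ℤ.* + τ ℤ.+ + 2 ℤ.* (+ d ℤ.* + k) ℤ.* (+ d ℤ.* u) ≡⟨ expandʳ (+ d) (+ (t % d)) (+ τ) (+ k) u ⟩
      + (t % d) ℤ.+ + d ℤ.* (+ τ ℤ.+ + d ℤ.* (+ 2 ℤ.* + k ℤ.* u))         ∎) r≡
    eq₂ : + b ℤ.+ + d ℤ.* (u ℤ.* u ℤ.+ + s) ≡ + (τ % d) ℤ.+ + d ℤ.* (+ (τ / d) ℤ.+ + 2 ℤ.* + k ℤ.* u)
    eq₂ = begin
      + b ℤ.+ + d ℤ.* (u ℤ.* u ℤ.+ + s)                                   ≡⟨ factorˡ (+ b) (+ d) (u ℤ.* u) (+ s) ⟩
      + d ℤ.* (u ℤ.* u) ℤ.+ (+ b ℤ.+ + d ℤ.* + s)                         ≡⟨ cong (λ z → + d ℤ.* (u ℤ.* u) ℤ.+ z) (pos-euclid b d s) ⟨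
      + d ℤ.* (u ℤ.* u) ℤ.+ + (b + d * s)                                 ≡⟨ eq₁ ⟩
      + τ ℤ.+ + d ℤ.* (+ 2 ℤ.* + k ℤ.* u)                                 ≡⟨ cong (λ z → z ℤ.+ + d ℤ.* (+ 2 ℤ.* + k ℤ.* u)) (euclid τ d) ⟩
      + (τ % d) ℤ.+ + d ℤ.* + (τ / d) ℤ.+ + d ℤ.* (+ 2 ℤ.* + k ℤ.* u)     ≡⟨ factorʳ (+ (τ % d)) (+ d) (+ (τ / d)) (+ 2 ℤ.* + k ℤ.* u) ⟩
      + (τ % d) ℤ.+ + d ℤ.* (+ (τ / d) ℤ.+ + 2 ℤ.* + k ℤ.* u)             ∎
    b≡ : b ≡ τ % d
    b≡ = remainder-unique _ _ eq₂ b<d (m%n<n τ d)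

  -- The shift set S and the choice of k.

  module Elements (p w : ℕ) .{{_ : NonZero p}} .{{_ : NonZero w}} (w<p : w < p) where

    digits : ∀ J → Fin ((2 * p) ^ suc J) → Fin 2 × Fin p × Fin ((2 * p) ^ J)
    digits J = remQuot₂ 2 p ((2 * p) ^ J)

    -- A Ruzsa-type set: the digits in base p at the J lowest even places lie in
    -- {0 , w}.  The leading digit 1 puts all elements between D and 2 * D, D = (p * p) ^ J.
    elem : ∀ J → Fin ((2 * p) ^ J) → ℕ
    elem zero    _ = 1
    elem (suc J) i = let r , b , j = digits J i in w * toℕ r + p * (toℕ b + p * elem J j)

    wr<p : ∀ (r : Fin 2) → w * toℕ r < p
    wr<p r = ℕ.≤-<-trans (ℕ.≤-trans (ℕ.*-monoʳ-≤ w (s≤s⁻¹ (toℕ<n r))) (ℕ.≤-reflexive (ℕ.*-identityʳ w))) w<p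

    elem-injective : ∀ J {i j} → elem J i ≡ elem J j → i ≡ j
    elem-injective zero    {Fin.zero} {Fin.zero} _ = refl
    elem-injective (suc J) {i} {j} eq =
      let r  , b  , i′ = digits J i
          r′ , b′ , j′ = digits J j
          r≡ , eq₁ = euclid-injective p (toℕ b + p * elem J i′) (toℕ b′ + p * elem J j′) eq (wr<p r) (wr<p r′)
          b≡ , eq₂ = euclid-injective p (elem J i′) (elem J j′) eq₁ (toℕ<n b) (toℕ<n b′)
      in remQuot₂-injective 2 p ((2 * p) ^ J) i j
           (cong₂ _,_ (toℕ-injective (ℕ.*-cancelˡ-≡ _ _ w r≡)) (cong₂ _,_ (toℕ-injective b≡) (elem-injective J eq₂)))

    elem-lower : ∀ J i → (p * p) ^ J ≤ elem J i
    elem-lower zero    _ = ℕ.≤-refl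
    elem-lower (suc J) i = let r , b , j = digits J i in begin
      (p * p) * (p * p) ^ J                               ≤⟨ ℕ.*-monoʳ-≤ (p * p) (elem-lower J j) ⟩
      (p * p) * elem J j                              ≡⟨ ℕ.*-assoc p p (elem J j) ⟩
      p * (p * elem J j)                        ≤⟨ ℕ.*-monoʳ-≤ p (ℕ.m≤n+m _ (toℕ b)) ⟩
      p * (toℕ b + p * elem J j)                ≤⟨ ℕ.m≤n+m _ (w * toℕ r) ⟩
      w * toℕ r + p * (toℕ b + p * elem J j)    ∎
      where open ℕ.≤-Reasoning

    elem-upper : ∀ J i → elem J i < 2 * (p * p) ^ J
    elem-upper zero    _ = ℕ.≤-refl
    elem-upper (suc J) i = let r , b , j = digits J i in
      subst (elem (suc J) i <_) (rearrange ((p * p) ^ J))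
        (euclid-< (wr<p r) (euclid-< (toℕ<n b) (elem-upper J j)))
      where
      rearrange : ∀ D → p * (p * (2 * D)) ≡ 2 * (p * p * D)
      rearrange = swap p
        where
        swap : ∀ p D → p * (p * (2 * D)) ≡ 2 * (p * p * D)
        swap = ℕ.solve-∀

    Dodges : ℕ → ℕ → ℕ → Set
    Dodges J t k = ∀ i u → Meets (elem J i) t k u → + (p ^ J) ∣ u

    -- Induction from the lowest digit of `t`. If it is obstructed, one digit `k` leaves no solution
    -- at all. If it is rigid, a multiple `p * k` kills the linear term modulo `p`, so `p` divides
    -- `u` and the lowest digits match; `meets-descend` then moves two places up. Each round uses
    -- two digits of `t` but only one of `k` and `u`, whence `k < p ^ J` for elements of size about
    -- `(p * p) ^ J`.
    dodge : (∀ t → Obstructed p w t ⊎ Rigid p w t) → ∀ J t → ∃[ k ] k < p ^ J × Dodges J t k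
    dodge residues zero    t = 0 , ℕ.≤-refl , λ _ u _ → divides u (sym (ℤ.*-identityʳ u))
    dodge residues (suc J) t with residues (fromℕ< (m%n<n t p))
    ... | inj₁ (k , obstructed) = toℕ k , ℕ.<-≤-trans (toℕ<n k) (ℕ.m≤m*n p (p ^ J) {{ℕ.m^n≢0 p J}}) , dodges
      where
      dodges : Dodges (suc J) t (toℕ k)
      dodges i u eq = let r , b , j = digits J i in
        contradiction (subst₂ (λ v s → (v * v + w * toℕ r) % p ≡ (s + 2 * toℕ k * v) % p)
                        (sym (toℕ-fromℕ< (n%ℕd<d u p))) (sym (toℕ-fromℕ< (m%n<n t p)))
                        (meets-mod p (w * toℕ r) (toℕ b + p * elem J j) t (toℕ k) u eq))
                      (obstructed r (fromℕ< (n%ℕd<d u p)))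
    ... | inj₂ rigid with dodge residues J (t / p / p)
    ...   | k , k<p^J , dodges′ = p * k , ℕ.*-monoʳ-< p k<p^J , dodges
      where
      linear-term-vanishes : ∀ t u → (t + 2 * (p * k) * u) % p ≡ t % p
      linear-term-vanishes t u = trans (cong (λ z → (t + z) % p) (assoc p k u)) ([m+kn]%n≡m%n t (2 * k * u) p)
        where
        assoc : ∀ p k u → 2 * (p * k) * u ≡ 2 * k * u * p
        assoc = ℕ.solve-∀
      dodges : Dodges (suc J) t (p * k)
      dodges i u eq =
        let r , b , j = digits J i
            u≡0 , r≡t = rigid r (fromℕ< (n%ℕd<d u p))
              (subst₂ (λ v s → (v * v + w * toℕ r) % p ≡ s % p)
                (sym (toℕ-fromℕ< (n%ℕd<d u p))) (sym (toℕ-fromℕ< (m%n<n t p)))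
                (trans (meets-mod p (w * toℕ r) (toℕ b + p * elem J j) t (p * k) u eq)
                       (linear-term-vanishes (t % p) (u %ℕ p))))
            u≡pu₁ = trans (euclidℤ u p) (trans (cong (λ v → + v ℤ.+ + p ℤ.* (u /ℕ p))
                       (trans (sym (toℕ-fromℕ< (n%ℕd<d u p))) u≡0)) (ℤ.+-identityˡ _))
            p^J∣u₁ = dodges′ j (u /ℕ p) (meets-descend p (elem J j) {t} k (u /ℕ p)
                        (trans r≡t (toℕ-fromℕ< (m%n<n t p))) (toℕ<n b)
                        (subst (Meets (elem (suc J) i) t (p * k)) u≡pu₁ eq))
        in subst₂ _∣_ (sym (ℤ.pos-* p (p ^ J))) (sym u≡pu₁) (ℤ.*-monoʳ-∣ (+ p) p^J∣u₁)

  -- Complements of injective images.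

  -- The values of `f` are removed one at a time, and each removal lowers the cardinality.
  avoid-range : ∀ {m n} (f : Fin m → Fin n) → Injective _≡_ _≡_ f →
                ∃ λ (N : Subset n) → m + Subset.∣ N ∣ ≤ n × (∀ y → (∀ i → y ≢ f i) → y ∈ N)
  avoid-range {zero}  {n} f _     = Subset.⊤ , ℕ.≤-reflexive (∣⊤∣≡n n) , λ _ _ → ∈⊤
  avoid-range {suc m} {n} f f-inj with avoid-range (f ∘ Fin.suc) (λ eq → suc-injective (f-inj eq))
  ... | N , m+∣N∣≤n , avoids =
    N Subset.- f Fin.zero ,
    ℕ.≤-trans (ℕ.≤-reflexive (sym (ℕ.+-suc m _))) (ℕ.≤-trans (ℕ.+-monoʳ-≤ m (x∈p⇒∣p-x∣<∣p∣ f0∈N)) m+∣N∣≤n) ,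
    λ y y∉f → x∈p∧x≢y⇒x∈p-y (avoids y (y∉f ∘ Fin.suc)) (y∉f Fin.zero)
    where
    -- By injectivity this value differs from all those already removed, so it is still there to be
    -- removed.
    f0∈N : f Fin.zero ∈ N
    f0∈N = avoids _ λ i eq → contradiction (f-inj eq) λ ()

  index-injective : ∀ {d q} → Injective _≡_ _≡_ (index {d} {q})
  index-injective {x = x} {y} eq = begin
    x                                   ≡⟨ point∘index x ⟨
    _                                   ≡⟨ tabulate-cong (λ i → cong (λ j → finToFun j i) eq) ⟩
    _                                   ≡⟨ point∘index y ⟩
    y                                   ∎
    where
    open ≡-Reasoning
    point∘index : ∀ x → _ ≡ x
    point∘index x = trans (tabulate-cong (finToFun-funToFin (lookup x))) (tabulate∘lookup x)

  -- Transfer between 𝔽 q and the integers.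

  module _ {q : ℕ} .{{_ : NonZero q}} .{{_ : Prime q}} where

    toℕ-fromℕ : ∀ n → toℕ (fromℕ {q} n) ≡ n % q
    toℕ-fromℕ n = toℕ-fromℕ< _

    fromℕ-residue : ∀ n → + q ∣ + toℕ (fromℕ {q} n) - + n
    fromℕ-residue n = divides (- (+ (n / q))) (begin
      + toℕ (fromℕ {q} n) - + n                        ≡⟨ cong₂ (λ a b → + a - b) (toℕ-fromℕ n) (euclid n q) ⟩
      + (n % q) - (+ (n % q) ℤ.+ + q ℤ.* + (n / q))    ≡⟨ cancel (+ (n % q)) (+ q) (+ (n / q)) ⟩
      - (+ (n / q)) ℤ.* + q                            ∎)
      where
      open ≡-Reasoning
      cancel : ∀ r d x → r - (r ℤ.+ d ℤ.* x) ≡ - x ℤ.* d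
      cancel = solve-∀

    fromℕ≡⇒∣ : ∀ {m n} → fromℕ {q} m ≡ fromℕ n → + q ∣ + m - + n
    fromℕ≡⇒∣ {m} {n} eq = ∣-resp
      (trans (cong (λ a → a - + n - (+ toℕ (fromℕ {q} m) - + m)) (cong (+_ ∘ toℕ) (sym eq)))
             (cancel (+ toℕ (fromℕ {q} m)) (+ m) (+ n)))
      (ℤ.∣m∣n⇒∣m-n (fromℕ-residue n) (fromℕ-residue m))
      where
      cancel : ∀ a m n → a - n - (a - m) ≡ m - n
      cancel = solve-∀

    ∣⇒fromℕ≡ : ∀ {m} {a : 𝔽 q} → + q ∣ + m - + toℕ a → fromℕ m ≡ a
    ∣⇒fromℕ≡ {m} {a} q∣m-a = toℕ-injective (congruent-close⇒≡
      (∣-resp (cancel (+ toℕ (fromℕ {q} m)) (+ m) (+ toℕ a)) (ℤ.∣m∣n⇒∣m+n (fromℕ-residue m) q∣m-a))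
      (ℕ.<-≤-trans (toℕ<n (fromℕ {q} m)) (ℕ.m≤n+m q _)) (ℕ.<-≤-trans (toℕ<n a) (ℕ.m≤n+m q _)))
      where
      cancel : ∀ a m n → a - m ℤ.+ (m - n) ≡ a - n
      cancel = solve-∀

    fromℕ∘toℕ : ∀ (a : 𝔽 q) → fromℕ (toℕ a) ≡ a
    fromℕ∘toℕ a = ∣⇒fromℕ≡ (divides (+ 0) (ℤ.i≡j⇒i-j≡0 {+ toℕ a} refl))

    fromℕ-injective : ∀ {m n} → m < q → n < q → fromℕ {q} m ≡ fromℕ n → m ≡ n
    fromℕ-injective m<q n<q eq =
      congruent-close⇒≡ (fromℕ≡⇒∣ eq) (ℕ.<-≤-trans m<q (ℕ.m≤n+m q _)) (ℕ.<-≤-trans n<q (ℕ.m≤n+m q _))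

    -- The reductions hidden in `fromℕ c` and in the product are undone by subtracting their
    -- residues, both multiples of `q`.
    line-coordinate : ∀ (a t : 𝔽 q) c {n} → a +𝔽 t *𝔽 fromℕ c ≡ fromℕ n → + q ∣ + (toℕ a) ℤ.+ + toℕ t ℤ.* + c - + n
    line-coordinate a t c {n} eq = ∣-resp
      (trans (cong (λ z → + toℕ a ℤ.+ y - + n - (y - z) - + toℕ t ℤ.* (x - + c)) (ℤ.pos-* (toℕ t) (toℕ (fromℕ {q} c))))
             (cancel (+ toℕ a) (+ toℕ t) (+ c) (+ n) x y))
      (ℤ.∣m∣n⇒∣m-n (ℤ.∣m∣n⇒∣m-n (fromℕ≡⇒∣ eq) (fromℕ-residue (toℕ t * toℕ (fromℕ {q} c)))) (ℤ.∣n⇒∣m*n (+ toℕ t) (fromℕ-residue c)))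
      where
      x = + toℕ (fromℕ {q} c)
      y = + toℕ (t *𝔽 fromℕ c)
      cancel : ∀ a t c n x y → a ℤ.+ y - n - (y - t ℤ.* x) - t ℤ.* (x - c) ≡ a ℤ.+ t ℤ.* c - n
      cancel = solve-∀

  ^-distribʳ-* : ∀ m n o → (m * n) ^ o ≡ m ^ o * n ^ o
  ^-distribʳ-* m n zero    = refl
  ^-distribʳ-* m n (suc o) = trans (cong (λ k → m * n * k) (^-distribʳ-* m n o)) (ℕ.[m*n]*[o*p]≡[m*o]*[n*p] m n (m ^ o) (n ^ o))

  -- Nonnegativity of a square in ℕ: the larger number is written as the smaller plus their
  -- difference.
  2mn≤m²+n² : ∀ m n → 2 * m * n ≤ m * m + n * n
  2mn≤m²+n² m n with ℕ.≤-total m n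
  ... | inj₁ m≤n = subst (λ n → 2 * m * n ≤ m * m + n * n) (ℕ.m+[n∸m]≡n m≤n)
    (ℕ.≤-trans (ℕ.m≤m+n _ ((n ∸ m) * (n ∸ m))) (ℕ.≤-reflexive (square m (n ∸ m))))
    where
    square : ∀ m d → 2 * m * (m + d) + d * d ≡ m * m + (m + d) * (m + d)
    square = ℕ.solve-∀
  ... | inj₂ n≤m = subst (λ m → 2 * m * n ≤ m * m + n * n) (ℕ.m+[n∸m]≡n n≤m)
    (ℕ.≤-trans (ℕ.m≤m+n _ ((m ∸ n) * (m ∸ n))) (ℕ.≤-reflexive (square n (m ∸ n))))
    where
    square : ∀ n d → 2 * (n + d) * n + d * d ≡ (n + d) * (n + d) + n * n
    square = ℕ.solve-∀

  pos-** : ∀ l m n → + (l * m * n) ≡ + l ℤ.* + m ℤ.* + n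
  pos-** l m n = trans (ℤ.pos-* (l * m) n) (cong (λ z → z ℤ.* + n) (ℤ.pos-* l m))

  -- The point set C and lines that miss it.

  module Parabolas (p w : ℕ) .{{_ : NonZero p}} .{{_ : NonZero w}} (w<p : w < p)
                   (residues : ∀ t → Obstructed p w t ⊎ Rigid p w t)
                   (q J : ℕ) .{{_ : NonZero q}} .{{_ : Prime q}} (6D≤q : 6 * (p * p) ^ J ≤ q) where

    open Elements p w w<p

    D L : ℕ
    D = (p * p) ^ J
    L = p ^ J

    L*L≡D : L * L ≡ D
    L*L≡D = sym (^-distribʳ-* p p J)

    *-<L : ∀ {m n} → m < L → n < L → m * n ≤ D
    *-<L m<L n<L = ℕ.≤-trans (ℕ.*-mono-≤ (ℕ.<⇒≤ m<L) (ℕ.<⇒≤ n<L)) (ℕ.≤-reflexive L*L≡D)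

    L≤q : L ≤ q
    L≤q = ℕ.≤-trans (ℕ.≤-trans (ℕ.m≤m*n L L {{ℕ.m^n≢0 p J}}) (ℕ.≤-reflexive L*L≡D)) (ℕ.≤-trans (ℕ.m≤n*m D 6) 6D≤q)

    coords : Fin (L * (2 * p) ^ J) → Fin L × Fin ((2 * p) ^ J)
    coords = remQuot {L} ((2 * p) ^ J)

    curve : Fin (L * (2 * p) ^ J) → Point 2 q
    curve i = let a , j = coords i in fromℕ (toℕ a) ∷ fromℕ (toℕ a * toℕ a + elem J j) ∷ []

    ordinate<q : ∀ (a : Fin L) j → toℕ a * toℕ a + elem J j < q
    ordinate<q a j = begin-strict
      toℕ a * toℕ a + elem J j   <⟨ ℕ.+-mono-≤-< (*-<L (toℕ<n a) (toℕ<n a)) (elem-upper J j) ⟩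
      D + 2 * D                  ≤⟨ ℕ.m≤m+n _ (3 * D) ⟩
      D + 2 * D + 3 * D          ≡⟨ add D ⟩
      6 * D                      ≤⟨ 6D≤q ⟩
      q                          ∎
      where
      open ℕ.≤-Reasoning
      add : ∀ D → D + 2 * D + 3 * D ≡ 6 * D
      add = ℕ.solve-∀

    curve-injective : Injective _≡_ _≡_ curve
    curve-injective {i} {i′} eq =
      let a  , j  = coords i
          a′ , j′ = coords i′
          eq₁ , eq₂ = ∷-injective eq
          a≡a′ = toℕ-injective {i = a} {a′} (fromℕ-injective (ℕ.<-≤-trans (toℕ<n a) L≤q) (ℕ.<-≤-trans (toℕ<n a′) L≤q) eq₁)
          s≡s′ = fromℕ-injective (ordinate<q a j) (ordinate<q a′ j′) (∷-injectiveˡ eq₂)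
      in remQuot-injective {L} ((2 * p) ^ J) i i′ (cong₂ _,_ a≡a′ (elem-injective J
           (ℕ.+-cancelˡ-≡ (toℕ a * toℕ a) _ _ (trans s≡s′ (cong (λ b → toℕ b * toℕ b + elem J j′) (sym a≡a′))))))

    EscapesCurve : Point 2 q → Set
    EscapesCurve x = ∃ λ v → v ≢ 𝟎 × (∀ y → ℓ* x v y → ∀ i → y ≢ curve i)

    -- The direction (0 , 1) keeps the abscissa `X`, while points of the curve have abscissa below
    -- `L`.
    vertical-escapes : ∀ X Y → L ≤ toℕ X → EscapesCurve (X ∷ Y ∷ [])
    vertical-escapes X Y L≤X = fromℕ 0 ∷ fromℕ 1 ∷ [] ,
      (λ eq → fromℕ0≢fromℕ1 {2} (sym (∷-injectiveˡ (∷-injectiveʳ eq)))) ,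
      λ { y ((t , refl) , _) i eq → ℕ.<⇒≱ (toℕ<n (proj₁ (coords i))) (ℕ.≤-trans L≤X (ℕ.≤-reflexive
        (congruent-close⇒≡
          (∣-resp (vanish (+ toℕ X) (+ toℕ t) (+ toℕ (proj₁ (coords i)))) (line-coordinate X t 0 (∷-injectiveˡ eq)))
          (ℕ.<-≤-trans (toℕ<n X) (ℕ.m≤n+m q _))
          (ℕ.<-≤-trans (ℕ.<-≤-trans (toℕ<n (proj₁ (coords i))) L≤q) (ℕ.m≤n+m q _))))) }
      where
      vanish : ∀ X t a → X ℤ.+ t ℤ.* + 0 - a ≡ X - a
      vanish = solve-∀

    module _ {t a X k s} (t<q : t < q) (a<L : a < L) (X<L : X < L) (k<L : k < L)
             (D≤s : D ≤ s) (s<2D : s < 2 * D) where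

      private
        -- The positive and the negative terms of `t + 2ku - u² - s` with `u = a - X`, separated so
        -- that a congruence modulo `q` compares two natural numbers.
        P N : ℕ
        P = t + (2 * k * a + 2 * a * X)
        N = s + (2 * k * X + (a * a + X * X))

      -- Completing the square, `P - N = t + k² - s - (a - X - k)²`. This is at most `t`, because
      -- `k² ≤ D ≤ s`; the leading digit 1 of the elements serves this bound.
      P<N+q : P < N + q
      P<N+q = begin-strict
        t + (2 * k * a + 2 * a * X)                 ≡⟨ cong (λ n → t + n) (factor k a X) ⟩
        t + 2 * a * (k + X)                         ≤⟨ ℕ.+-monoʳ-≤ t (2mn≤m²+n² a (k + X)) ⟩
        t + (a * a + (k + X) * (k + X))             ≡⟨ cong (λ n → t + n) (expand k a X) ⟩
        t + (k * k + (2 * k * X + (a * a + X * X))) <⟨ ℕ.+-mono-<-≤ t<q (ℕ.+-monoˡ-≤ _ (ℕ.≤-trans (*-<L k<L k<L) D≤s)) ⟩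
        q + N                                       ≡⟨ ℕ.+-comm q N ⟩
        N + q                                       ∎
        where
        open ℕ.≤-Reasoning
        factor : ∀ k a X → 2 * k * a + 2 * a * X ≡ 2 * a * (k + X)
        factor = ℕ.solve-∀
        expand : ∀ k a X → a * a + (k + X) * (k + X) ≡ k * k + (2 * k * X + (a * a + X * X))
        expand = ℕ.solve-∀

      -- Source of the constant 6: `s` and `2kX` contribute at most `2 * D` each, `a²` and `X²` at
      -- most `D` each.
      N<P+q : N < P + q
      N<P+q = begin-strict
        s + (2 * k * X + (a * a + X * X))           <⟨ ℕ.+-mono-<-≤ s<2D (ℕ.+-mono-≤ (ℕ.≤-trans (ℕ.≤-reflexive (ℕ.*-assoc 2 k X)) (ℕ.*-monoʳ-≤ 2 (*-<L k<L X<L)))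
                                                        (ℕ.+-mono-≤ (*-<L a<L a<L) (*-<L X<L X<L))) ⟩
        2 * D + (2 * D + (D + D))                   ≡⟨ add D ⟩
        6 * D                                       ≤⟨ 6D≤q ⟩
        q                                           ≤⟨ ℕ.m≤n+m q P ⟩
        P + q                                       ∎
        where
        open ℕ.≤-Reasoning
        add : ∀ D → 2 * D + (2 * D + (D + D)) ≡ 6 * D
        add = ℕ.solve-∀

      congruent⇒meets : + q ∣ + t ℤ.+ + 2 ℤ.* + k ℤ.* (+ a - + X) - ((+ a - + X) ℤ.* (+ a - + X) ℤ.+ + s) → Meets s t k (+ a - + X)
      congruent⇒meets q∣ = sym (ℤ.i-j≡0⇒i≡j _ _ (trans (sym difference) (ℤ.i≡j⇒i-j≡0 (cong +_ P≡N))))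
        where
        regroup : ∀ t k a X s → t ℤ.+ (+ 2 ℤ.* k ℤ.* a ℤ.+ + 2 ℤ.* a ℤ.* X) - (s ℤ.+ (+ 2 ℤ.* k ℤ.* X ℤ.+ (a ℤ.* a ℤ.+ X ℤ.* X)))
                ≡ t ℤ.+ + 2 ℤ.* k ℤ.* (a - X) - ((a - X) ℤ.* (a - X) ℤ.+ s)
        regroup = solve-∀
        difference : + P - + N ≡ + t ℤ.+ + 2 ℤ.* + k ℤ.* (+ a - + X) - ((+ a - + X) ℤ.* (+ a - + X) ℤ.+ + s)
        difference = trans
          (cong₂ _-_ (cong₂ (λ x y → + t ℤ.+ (x ℤ.+ y)) (pos-** 2 k a) (pos-** 2 a X))
                     (cong₂ (λ x y → + s ℤ.+ (x ℤ.+ y)) (pos-** 2 k X) (cong₂ ℤ._+_ (ℤ.pos-* a a) (ℤ.pos-* X X))))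
          (regroup (+ t) (+ k) (+ a) (+ X) (+ s))
        P≡N : P ≡ N
        P≡N = congruent-close⇒≡ (∣-resp (sym difference) q∣) P<N+q N<P+q

    module _ (X Y : 𝔽 q) (X<L : toℕ X < L) where

      private
        x₀ y₀ t : ℕ
        x₀ = toℕ X
        y₀ = toℕ Y
        -- The height of the base point above the parabola, as a residue in [0 , q).
        t = (+ y₀ - + (x₀ * x₀)) %ℕ q

        q∣t : + q ∣ + y₀ - + (x₀ * x₀) - + t
        q∣t = divides ((+ y₀ - + (x₀ * x₀)) /ℕ q) (trans (cong (λ z → z - + t) (a≡a%ℕn+[a/ℕn]*n (+ y₀ - + (x₀ * x₀)) q)) (cancel (+ t) _))
          where
          cancel : ∀ t z → t ℤ.+ z - t ≡ z
          cancel = solve-∀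

        k : ℕ
        k = proj₁ (dodge residues J t)

        k<L : k < L
        k<L = proj₁ (proj₂ (dodge residues J t))

        dodges : Dodges J t k
        dodges = proj₂ (proj₂ (dodge residues J t))

        -- The slope `2 * x₀` of the tangent to the parabola at `x₀` cancels the cross term of
        -- `(x₀ + u)²`; the correction leaves `2ku`.
        slope : ℕ
        slope = 2 * (x₀ + k)

      -- The parameter `τ` is eliminated by subtracting `slope` times the abscissa congruence from
      -- the ordinate congruence; `q∣t` replaces `y₀` by `x₀² + t`.
      on-line⇒meets : ∀ (τ : 𝔽 q) i → let a , j = coords i in
        X +𝔽 τ *𝔽 fromℕ 1 ≡ fromℕ (toℕ a) → Y +𝔽 τ *𝔽 fromℕ slope ≡ fromℕ (toℕ a * toℕ a + elem J j) →
        Meets (elem J j) t k (+ toℕ a - + x₀)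
      on-line⇒meets τ i eq₁ eq₂ =
        let a , j = coords i
        in congruent⇒meets (n%ℕd<d (+ y₀ - + (x₀ * x₀)) q) (toℕ<n a) X<L k<L (elem-lower J j) (elem-upper J j)
          (∣-resp (eliminate (+ y₀) (+ toℕ τ) (+ x₀) (+ k) (+ toℕ a) (+ elem J j) (+ t)
                     (ℤ.pos-* 2 (x₀ + k)) (ℤ.pos-* (toℕ a) (toℕ a)) (ℤ.pos-* x₀ x₀))
            (ℤ.∣m∣n⇒∣m-n (ℤ.∣m∣n⇒∣m-n (line-coordinate Y τ slope eq₂) q∣t)
                         (ℤ.∣n⇒∣m*n (+ slope) (line-coordinate X τ 1 eq₁))))
        where
        identity : ∀ y τ x k a s t →
          y ℤ.+ τ ℤ.* (+ 2 ℤ.* (x ℤ.+ k)) - (a ℤ.* a ℤ.+ s) - (y - x ℤ.* x - t)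
            - + 2 ℤ.* (x ℤ.+ k) ℤ.* (x ℤ.+ τ ℤ.* + 1 - a)
          ≡ t ℤ.+ + 2 ℤ.* k ℤ.* (a - x) - ((a - x) ℤ.* (a - x) ℤ.+ s)
        identity = solve-∀
        eliminate : ∀ y τ x k a s t {m a² x²} → m ≡ + 2 ℤ.* (x ℤ.+ k) → a² ≡ a ℤ.* a → x² ≡ x ℤ.* x →
          y ℤ.+ τ ℤ.* m - (a² ℤ.+ s) - (y - x² - t) - m ℤ.* (x ℤ.+ τ ℤ.* + 1 - a)
          ≡ t ℤ.+ + 2 ℤ.* k ℤ.* (a - x) - ((a - x) ℤ.* (a - x) ℤ.+ s)
        eliminate y τ x k a s t refl refl refl = identity y τ x k a s t

      -- `L` divides the difference of two numbers in [0 , L), so the abscissas coincide. The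
      -- equation at offset 0 then says that the shift equals `t`.
      meets⇒base-point : ∀ i → let a , j = coords i in
        Meets (elem J j) t k (+ toℕ a - + x₀) → curve i ≡ X ∷ Y ∷ []
      meets⇒base-point i eq =
        let a , j = coords i
            a≡x₀ = congruent-close⇒≡ (dodges j (+ toℕ a - + x₀) eq)
                     (ℕ.<-≤-trans (toℕ<n a) (ℕ.m≤n+m L _)) (ℕ.<-≤-trans X<L (ℕ.m≤n+m L _))
            s≡t = ℤ.+-injective (trans (sym (squareˡ (+ x₀) (+ elem J j)))
                    (trans (subst (λ b → Meets (elem J j) t k (+ b - + x₀)) a≡x₀ eq) (squareʳ (+ x₀) (+ t) (+ k))))
        in cong₂ (λ u v → u ∷ v ∷ []) (trans (cong fromℕ a≡x₀) (fromℕ∘toℕ X))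
             (trans (cong₂ (λ b s → fromℕ (b * b + s)) a≡x₀ s≡t)
               (∣⇒fromℕ≡ (∣-resp (negate (+ y₀) (+ (x₀ * x₀)) (+ t)) (ℤ.∣m⇒∣-m q∣t))))
        where
        squareˡ : ∀ x s → (x - x) ℤ.* (x - x) ℤ.+ s ≡ s
        squareˡ = solve-∀
        squareʳ : ∀ x t k → t ℤ.+ + 2 ℤ.* k ℤ.* (x - x) ≡ t
        squareʳ = solve-∀
        negate : ∀ y z t → - (y - z - t) ≡ z ℤ.+ t - y
        negate = solve-∀

      slanted-escapes : EscapesCurve (X ∷ Y ∷ [])
      slanted-escapes = fromℕ 1 ∷ fromℕ slope ∷ [] ,
        (λ eq → fromℕ0≢fromℕ1 {2} (sym (∷-injectiveˡ eq))) ,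
        λ { y ((τ , refl) , y≢x) i eq →
            let eq₁ , eq₂ = ∷-injective eq
            in y≢x (trans eq (meets⇒base-point i (on-line⇒meets τ i eq₁ (∷-injectiveˡ eq₂)))) }

    escapes : ∀ x → EscapesCurve x
    escapes (X ∷ Y ∷ []) with toℕ X ℕ.<? L
    ... | yes X<L = slanted-escapes X Y X<L
    ... | no  X≮L = vertical-escapes X Y (ℕ.≮⇒≥ X≮L)

    -- By `escapes`, the complement of the curve is a Nikodym set; minimality bounds `Nikodym 2 q`
    -- by its size.
    Nikodym-upper : L * (2 * p) ^ J + Nikodym 2 q ≤ q ^ 2
    Nikodym-upper =
      let N , card , avoids = avoid-range (index ∘ curve) (λ eq → curve-injective (index-injective eq))
          nikodym : IsNikodym 2 q N
          nikodym x = let v , v≢0 , ℓ∌curve = escapes x in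
            v , v≢0 , λ y y∈ℓ → avoids (index y) (λ i eq → ℓ∌curve y y∈ℓ i (index-injective eq))
      in ℕ.≤-trans (ℕ.+-monoʳ-≤ (L * (2 * p) ^ J) (proj₂ (proj₂ (leastNikodymSize 2 q)) Subset.∣ N ∣ (N , nikodym , refl))) card

  -- Choice of J and the exponent of the saving.

  n<m^n : ∀ {m} → 1 < m → ∀ n → n < m ^ n
  n<m^n     1<m zero    = ℕ.≤-refl
  n<m^n {m} 1<m (suc n) = ℕ.≤-<-trans (n<m^n 1<m n) (ℕ.^-monoʳ-< m 1<m (ℕ.n<1+n n))

  -- Upward search for the first step at which `f` passes `q`, with `n` as fuel;
  -- `f J ≤ q < f (n + J)` is kept throughout, so the fuel suffices.
  bracket : ∀ (f : ℕ → ℕ) {q} n J → f J ≤ q → q < f (n + J) → ∃[ K ] J ≤ K × f K ≤ q × q < f (suc K)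
  bracket f zero    J fJ≤q q<fJ = contradiction fJ≤q (ℕ.<⇒≱ q<fJ)
  bracket f {q} (suc n) J fJ≤q q<f with f (suc J) ℕ.≤? q
  ... | no  f≰q = J , ℕ.≤-refl , fJ≤q , ℕ.≰⇒> f≰q
  ... | yes f≤q with bracket f n (suc J) f≤q (subst (λ m → q < f m) (sym (ℕ.+-suc n J)) q<f)
  ...   | K , J<K , fK≤q , q<f[1+K] = K , ℕ.<⇒≤ J<K , fK≤q , q<f[1+K]

  ^-comm : ∀ a m n → (a ^ m) ^ n ≡ (a ^ n) ^ m
  ^-comm a m n = trans (ℕ.^-*-assoc a m n) (trans (cong (a ^_) (ℕ.*-comm m n)) (sym (ℕ.^-*-assoc a n m)))

  -- For `J` at least `h * m`, the constant `b ^ h` costs at most one factor `b` per level, so the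
  -- asymptotic comparison follows from one numerical inequality raised to the power `J`.
  ^-absorb : ∀ {q b c d} h J m n .{{_ : NonZero b}} → q ≤ b ^ h * d ^ J → h * m ≤ J →
             b * d ^ m ≤ c ^ n → q ^ m ≤ (c ^ J) ^ n
  ^-absorb {q} {b} {c} {d} h J m n q≤ hm≤J bd≤c = begin
    q ^ m                          ≤⟨ ℕ.^-monoˡ-≤ m q≤ ⟩
    (b ^ h * d ^ J) ^ m            ≡⟨ ^-distribʳ-* (b ^ h) (d ^ J) m ⟩
    (b ^ h) ^ m * (d ^ J) ^ m      ≡⟨ cong₂ _*_ (ℕ.^-*-assoc b h m) (^-comm d J m) ⟩
    b ^ (h * m) * (d ^ m) ^ J      ≤⟨ ℕ.*-monoˡ-≤ ((d ^ m) ^ J) (ℕ.^-monoʳ-≤ b hm≤J) ⟩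
    b ^ J * (d ^ m) ^ J            ≡⟨ ^-distribʳ-* b (d ^ m) J ⟨
    (b * d ^ m) ^ J                ≤⟨ ℕ.^-monoˡ-≤ J bd≤c ⟩
    (c ^ n) ^ J                    ≡⟨ ^-comm c n J ⟩
    (c ^ J) ^ n                    ∎
    where open ℕ.≤-Reasoning

  module _ (p w : ℕ) .{{_ : NonZero p}} .{{_ : NonZero w}} (w<p : w < p)
           (residues : ∀ t → Obstructed p w t ⊎ Rigid p w t)
           (h m n : ℕ) (6p²≤2^h : 6 * (p * p) ≤ 2 ^ h) (2p²^m≤ : 2 * (p * p) ^ m ≤ (p * (2 * p)) ^ n) where

    -- `J` is chosen with `6D ≤ q < 6p²D` for `D = (p * p) ^ J`: the first bound admits the
    -- construction, the second keeps the saving large relative to `q`. Starting the search at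
    -- `h * m` meets the requirement of `^-absorb`.
    nikodym-saving : ∀ q .{{_ : Prime q}} → 6 * (p * p) ^ (h * m) ≤ q →
                     Nikodym 2 q ≤ q ^ 2 × q ^ m ≤ (q ^ 2 ∸ Nikodym 2 q) ^ n
    nikodym-saving q q₀≤q
      with bracket (λ J → 6 * (p * p) ^ J) q (h * m) q₀≤q q<
      where
      1<p : 1 < p
      1<p = ℕ.≤-<-trans (ℕ.n≢0⇒n>0 (≢-nonZero⁻¹ w)) w<p
      -- A crude end of the search: `(p * p) ^ q` already exceeds `q`.
      q< : q < 6 * (p * p) ^ (q + h * m)
      q< = ℕ.<-≤-trans (n<m^n (ℕ.*-mono-< 1<p 1<p) q)
        (ℕ.≤-trans (ℕ.^-monoʳ-≤ (p * p) {{ℕ.m*n≢0 p p}} (ℕ.m≤m+n q (h * m))) (ℕ.m≤n*m _ 6))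
    ... | J , hm≤J , 6D≤q , q<6p²D =
      ℕ.≤-trans (ℕ.m≤n+m _ (p ^ J * (2 * p) ^ J)) upper ,
      ℕ.≤-trans (^-absorb h J m n q≤2^hD hm≤J 2p²^m≤)
        (ℕ.^-monoˡ-≤ n (ℕ.≤-trans (ℕ.≤-reflexive (^-distribʳ-* p (2 * p) J)) (ℕ.m+n≤o⇒m≤o∸n _ upper)))
      where
      instance
        q≢0 : NonZero q
        q≢0 = >-nonZero (ℕ.≤-trans (ℕ.*-mono-≤ {1} {6} (s≤s z≤n) (ℕ.m^n>0 (p * p) {{ℕ.m*n≢0 p p}} J)) 6D≤q)
      upper : p ^ J * (2 * p) ^ J + Nikodym 2 q ≤ q ^ 2
      upper = Parabolas.Nikodym-upper p w w<p residues q J 6D≤q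
      q≤2^hD : q ≤ 2 ^ h * (p * p) ^ J
      q≤2^hD = ℕ.≤-trans (ℕ.<⇒≤ q<6p²D) (ℕ.≤-trans (ℕ.≤-reflexive (sym (ℕ.*-assoc 6 (p * p) _))) (ℕ.*-monoˡ-≤ _ 6p²≤2^h))

  -- A finite check. The digits 0 and 3 are rigid because 3 and -3 are nonsquares modulo 17; for
  -- every other `t` some `k` makes both `t + k²` and `t + k² - 3` nonsquares.
  residues₁₇ : ∀ t → Obstructed 17 3 t ⊎ Rigid 17 3 t
  residues₁₇ = from-yes (all? (obstructed⊎rigid? 17 3))

open import Data.Integer.Base using (+_)
open import Data.Nat.Base using (ℕ; _≤_; _^_)
open import Data.Nat.Primality using (Prime)
import Data.Nat.Properties as ℕ
open import Data.Product.Base using (∃-syntax; _×_; _,_)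
import Data.Rational.Properties as ℚ
open import Relation.Nullary.Decidable using (from-yes)
open import Data.Rational.Base as ℚ using (ℚ; 0ℚ; 1ℚ; _+_; _<_)

-- The saving is 2^J D with D = 289^J and q < 6 · 289 · D ≤ 2^11 D.  Since
-- 2 · 289 ≤ 2^10, it is at least q^(11/10) once J ≥ 11 · 11.
theorem1p11 : ∃[ c ] (0ℚ < c × (∃[ q₀ ] ((q : ℕ) → {{_ : Prime q}} → q₀ ≤ q →
    Nikodym 2 q ≤ q ^ 2 -[ q ^ℚ 1ℚ + c ])))
-- The threshold `_` is solved by unification as `6 * (17 * 17) ^ (11 * 11)`.
theorem1p11 = + 1 ℚ./ 10 , from-yes (0ℚ ℚ.<? (+ 1 ℚ./ 10)) , _ ,
  λ q → Construction.nikodym-saving 17 3 (from-yes (3 ℕ.<? 17)) Construction.residues₁₇ 11 11 10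
    (ℕ.≤ᵇ⇒≤ _ _ _) (ℕ.≤ᵇ⇒≤ _ _ _) q
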